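{- The satisfiability problem of the modal logic $\mathcal{B}(\langle r\rangle,\mathsf{k})$ is undecidable: there is no algorithm which, given as input a formula $\varphi$ of $\mathcal{B}(\langle r\rangle,\mathsf{k})$, decides whether there exist a frame $\mathcal{M}=\langle W,R\rangle$ and a state $w\in W$ such that $\mathcal{M},\emptyset,w\models\varphi$.
   Context: **Syntax.** Formulas of $\mathcal{B}(\langle r\rangle,\mathsf{k})$ are generated by the grammar $F ::= \neg F \mid F_1\wedge F_2 \mid \Diamond F \mid \mathsf{k}$. Here $\Diamond$ is the "remember-and-move" operator $\langle r\rangle$ and $\mathsf{k}$ is the nullary "known" operator. There are no propositional symbols and no nominals; $\mathsf{k}$ is the only atom. **Semantics.** A frame (model) is a pair $\mathcal{M}=\langle W,R\rangle$, where $W$ is a set of states and $R\subseteq W\times W$ is an arbitrary binary relation. Formulas are evaluated at a state $w\in W$ relative to a memory $S\subseteq W$ (the set of visited states): - $\mathcal{M},S,w\models\neg\varphi$ iff $\mathcal{M},S,w\not\models\varphi$; - $\mathcal{M},S,w\models\varphi\wedge\psi$ iff $\mathcal{M},S,w\models\varphi$ and $\mathcal{M},S,w\models\psi$; - $\mathcal{M},S,w\models\Diamond\varphi$ iff there exists $t\in W$ such that $R\,w\,t$ and $\mathcal{M},S\cup\{w\},t\models\varphi$; - $\mathcal{M},S,w\models\mathsf{k}$ iff $w\in S$. **Satisfiability.** A formula $\varphi$ is satisfiable if there exist a frame $\mathcal{M}=\langle W,R\rangle$ and $w\in W$ with $\mathcal{M},\emptyset,w\models\varphi$ (the initial memory is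 empty). Frames may be finite or infinite. -}

module Defs where

open import Data.Fin.Base using (Fin)
open import Data.List.Base using (List; []; _∷_; [_]; _++_; map)
open import Data.List.Properties using (++-assoc; ∷-injectiveʳ)
open import Data.Nat.Base using (ℕ)
open import Data.Nat.GeneralisedArithmetic using (iterate)
open import Data.Product.Base using (Σ; ∃-syntax; _×_; _,_; proj₁)
open import Level using (0ℓ)
open import Relation.Binary.Core using (Rel)
open import Relation.Binary.PropositionalEquality using (_≡_; refl; sym; trans; cong)
open import Relation.Nullary using (¬_)
open import Relation.Unary using (Pred; ∅; ｛_｝; _∪_; _∈_)

infixr 6 _∧_
infix  8 ∼_ ◇_

data Formula : Set where
  ∼_  : Formula → Formula
  _∧_ : Formula → Formula → Formula
  ◇_  : Formula → Formula
  𝗄   : Formula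

record Frame : Set₁ where
  field
    W : Set
    R : Rel W 0ℓ

infix 4 _,_,_⊨_

_,_,_⊨_ : (M : Frame) → Pred (Frame.W M) 0ℓ → Frame.W M → Formula → Set
M , S , w ⊨ ∼ φ   = ¬ (M , S , w ⊨ φ)
M , S , w ⊨ φ ∧ ψ = (M , S , w ⊨ φ) × (M , S , w ⊨ ψ)
M , S , w ⊨ ◇ φ   = ∃[ t ] (Frame.R M w t × (M , S ∪ ｛ w ｝ , t ⊨ φ))
M , S , w ⊨ 𝗄     = w ∈ S

Satisfiable : Formula → Set₁
Satisfiable φ = Σ Frame λ M → Σ (Frame.W M) λ w → M , ∅ , w ⊨ φ

-- The tape alphabet consists of the blank, the input letters and a
-- finite supply of further work symbols.
data Symbol (A : Set) (m : ℕ) : Set where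
  blank  : Symbol A m
  letter : A → Symbol A m
  work   : Fin m → Symbol A m

data Control (n : ℕ) : Set where
  state  : Fin n → Control n
  accept : Control n
  reject : Control n

data Direction : Set where
  left right : Direction

record TM (A : Set) : Set where
  field
    #states : ℕ
    #work   : ℕ
    start   : Control #states
    δ       : Fin #states → Symbol A #work →
              Control #states × Symbol A #work × Direction

-- A two-way infinite tape: `before` is listed from the head outwards,
-- and all cells beyond the ends of the two lists are blank.
record Tape (Γ : Set) : Set where
  constructor tape
  field
    before : List Γ
    scan   : Γ
    after  : List Γ

module _ {A : Set} {m : ℕ} where

  load : List (Symbol A m) → Tape (Symbol A m)
  load []       = tape [] blank []
  load (a ∷ as) = tape [] a as

  write : Symbol A m → Tape (Symbol A m) → Tape (Symbol A m)
  write b (tape ls _ rs) = tape ls b rs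

  move : Direction → Tape (Symbol A m) → Tape (Symbol A m)
  move left  (tape []       a rs)       = tape [] blank (a ∷ rs)
  move left  (tape (l ∷ ls) a rs)       = tape ls l (a ∷ rs)
  move right (tape ls       a [])       = tape (a ∷ ls) blank []
  move right (tape ls       a (r ∷ rs)) = tape (a ∷ ls) r rs

module _ {A : Set} (T : TM A) where
  open TM T

  Config : Set
  Config = Control #states × Tape (Symbol A #work)

  initial : List A → Config
  initial w = start , load (map letter w)

  -- Halted configurations are fixed points.
  step : Config → Config
  step (state q , t) = let (q′ , b , d) = δ q (Tape.scan t) in q′ , move d (write b t)
  step (accept  , t) = accept , t
  step (reject  , t) = reject , t

  Accepts : List A → Set
  Accepts w = ∃[ n ] proj₁ (iterate step (initial w) n) ≡ accept

  Rejects : List A → Set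
  Rejects w = ∃[ n ] proj₁ (iterate step (initial w) n) ≡ reject

data Letter : Set where
  ⟨∼⟩ ⟨∧⟩ ⟨◇⟩ ⟨𝗄⟩ : Letter

-- Polish notation, hence uniquely readable without brackets.
encode : Formula → List Letter
encode (∼ φ)   = ⟨∼⟩ ∷ encode φ
encode (φ ∧ ψ) = ⟨∧⟩ ∷ encode φ ++ encode ψ
encode (◇ φ)   = ⟨◇⟩ ∷ encode φ
encode 𝗄       = [ ⟨𝗄⟩ ]

encode-prefix-free : ∀ φ ψ {u v} → encode φ ++ u ≡ encode ψ ++ v → φ ≡ ψ × u ≡ v
encode-prefix-free (∼ φ) (∼ ψ) eq with refl , e ← encode-prefix-free φ ψ (∷-injectiveʳ eq) = refl , e
encode-prefix-free (◇ φ) (◇ ψ) eq with refl , e ← encode-prefix-free φ ψ (∷-injectiveʳ eq) = refl , e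
encode-prefix-free 𝗄     𝗄     eq = refl , ∷-injectiveʳ eq
encode-prefix-free (φ₁ ∧ φ₂) (ψ₁ ∧ ψ₂) {u} {v} eq
  with refl , e ← encode-prefix-free φ₁ ψ₁
         (trans (sym (++-assoc (encode φ₁) (encode φ₂) u))
                (trans (∷-injectiveʳ eq) (++-assoc (encode ψ₁) (encode ψ₂) v)))
  with refl , e′ ← encode-prefix-free φ₂ ψ₂ e = refl , e′

encode-injective : ∀ {φ ψ} → encode φ ≡ encode ψ → φ ≡ ψ
encode-injective {φ} {ψ} eq = proj₁ (encode-prefix-free φ ψ (cong (_++ []) eq))

-- Totality on encoded formulas is not assumed separately: classically it
-- follows from the two implications, and constructively leaving it out
-- makes an undecidability claim stronger.
Decides : TM Letter → (Formula → Set₁) → Set₁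
Decides T P = ∀ φ → (P φ → Accepts T (encode φ)) × (¬ P φ → Rejects T (encode φ))

{-# OPTIONS --safe #-}
module Submission where

-- Labels come for free: attach to a state a terminating chain whose length codes
-- the label. A spy point that sees, and is seen by, every state can then collect
-- states in the memory, and the label of a remembered state identifies it. So a
-- formula can describe a machine with two stacks: configurations are states pointing
-- to linked lists, and the formula says that every configuration has a successor
-- sharing the tails of its lists, and that no configuration is accepting.
--
-- Given a machine T, the rules of such a stack machine form a formula A, and a list p
-- is described by a formula whose encoding is, letter by letter, a homomorphic
-- image of p. For p = encode A the stack machine can thus write down the encoding of
-- the conjunction φ of the two and run T on it. Then φ is satisfiable exactly if
-- T does not accept φ.

open import Defs
open import Data.Bool.Base using (Bool; true; false; not)
open import Data.Bool.Properties using (not-involutive)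
open import Data.Empty using (⊥)
open import Data.Fin.Base using (Fin; zero; suc; toℕ)
open import Data.Fin.Properties using (toℕ-injective; toℕ<n)
open import Data.List.Base using (List; []; _∷_; [_]; _++_; _ʳ++_; allFin; cartesianProductWith; concatMap; drop; foldr; head; length; lookup; map)
open import Data.List.Membership.Propositional using (_∈_; lose)
open import Data.List.Membership.Propositional.Properties using (∈-++⁺ˡ; ∈-++⁺ʳ; ∈-allFin; ∈-cartesianProductWith⁺; ∈-concatMap⁺; ∈-map⁺)
open import Data.List.Properties using (++-assoc; ++-identityʳ; ++-ʳ++; concatMap-pure; map-++; ʳ++-ʳ++)
open import Data.List.Relation.Unary.All using (All; []; _∷_)
open import Data.List.Relation.Unary.Any using (here; there; index)
open import Data.List.Relation.Unary.Any.Properties using (lookup-index)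
open import Data.Maybe.Base as Maybe using (Maybe; just; nothing; fromMaybe; maybe)
open import Data.Nat.Base using (ℕ; zero; suc; _+_; _*_; _∸_; _≤_; _<_; z≤n; s≤s)
open import Data.Nat.GeneralisedArithmetic using (fold; fold-+; iterate; iterate-is-fold)
open import Data.Nat.Properties using (+-cancelˡ-≡; +-comm; <-cmp; <-irrefl; ≤-refl; ≤-trans; m≤m+n; m≤m*n; m∸n+n≡m; n<1+n)
open import Data.Product.Base using (∃-syntax; _×_; _,_; proj₁; proj₂)
open import Data.Sum.Base using (_⊎_; inj₁; inj₂)
open import Data.Sum.Properties using (inj₁-injective)
open import Data.Unit.Base using (⊤; tt)
open import Function.Base using (_$_; _∘_; id)
open import Level using (0ℓ)
open import Relation.Binary.Definitions using (tri<; tri≈; tri>)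
open import Relation.Binary.PropositionalEquality using (_≡_; _≢_; refl; sym; trans; cong; cong₂; subst; module ≡-Reasoning)
open import Relation.Nullary using (¬_; contradiction)
open import Relation.Unary using (Pred; ∅; ｛_｝; _∪_)

-- Finite types with numbered elements.

record Finite (A : Set) : Set where
  field
    elements : List A
    complete : ∀ x → x ∈ elements

  -- Opaque, because comparing formulas must not unfold the numbers of concrete labels.
  opaque
    rank : A → ℕ
    rank x = toℕ (index (complete x))

    rank< : ∀ x → rank x < length elements
    rank< x = toℕ<n (index (complete x))

    rank-injective : ∀ {x y} → rank x ≡ rank y → x ≡ y
    rank-injective {x} {y} eq =
      trans (lookup-index (complete x))
        (trans (cong (lookup elements) (toℕ-injective eq)) (sym (lookup-index (complete y))))

open Finite using (elements; complete)

finite-Bool : Finite Bool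
finite-Bool .elements = true ∷ false ∷ []
finite-Bool .complete true  = here refl
finite-Bool .complete false = there (here refl)

finite-Maybe : ∀ {A} → Finite A → Finite (Maybe A)
finite-Maybe fin .elements = nothing ∷ map just (elements fin)
finite-Maybe fin .complete nothing  = here refl
finite-Maybe fin .complete (just x) = there (∈-map⁺ just (complete fin x))

finite-× : ∀ {A B} → Finite A → Finite B → Finite (A × B)
finite-× finA finB .elements = cartesianProductWith _,_ (elements finA) (elements finB)
finite-× finA finB .complete (x , y) = ∈-cartesianProductWith⁺ _,_ (complete finA x) (complete finB y)

-- Boxes yield their bodies only under a double negation, so the arguments about models are
-- do-blocks in the double-negation monad.
_>>=_ : ∀ {A B : Set} → ¬ ¬ A → (A → ¬ ¬ B) → ¬ ¬ B
(m >>= f) ¬b = m λ a → f a ¬b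

return : ∀ {A : Set} → A → ¬ ¬ A
return a ¬a = ¬a a

-- Marks: labels expressed by heights of chains.

falsum verum : Formula
falsum = 𝗄 ∧ ∼ 𝗄
verum  = ∼ falsum

-- `low n` says that the height is below n. The mark n plays the part of a
-- propositional letter: the least height of a successor is n, and some
-- successor is higher, which fails on the chain of heights itself.
low : ℕ → Formula
low zero    = falsum
low (suc n) = ∼ ◇ ∼ low n

mark : ℕ → Formula
mark n = ◇ low (suc n) ∧ (∼ ◇ low n ∧ ◇ ∼ low (suc n))

module Marks (M : Frame) where
  open Frame M

  -- In `low n` the atom `𝗄` occurs only inside `falsum`, so the truth of `low` and `mark` does not
  -- depend on the memory; `Low` and `Marked` state it without one.
  Low : ℕ → W → Set
  Low zero    w = ⊥
  Low (suc n) w = ¬ (∃[ t ] (R w t × ¬ Low n t))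

  Marked : ℕ → W → Set
  Marked n w = (∃[ t ] (R w t × Low (suc n) t)) × ¬ (∃[ t ] (R w t × Low n t)) × (∃[ t ] (R w t × ¬ Low (suc n) t))

  low⇒Low : ∀ n {S w} → M , S , w ⊨ low n → Low n w
  Low⇒low : ∀ n {S w} → Low n w → M , S , w ⊨ low n
  low⇒Low zero    (k , ¬k)        = ¬k k
  low⇒Low (suc n) p (t , r , ¬q) = p (t , r , λ q → ¬q (low⇒Low n q))
  Low⇒low (suc n) p (t , r , ¬q) = p (t , r , λ q → ¬q (Low⇒low n q))

  mark⇒Marked : ∀ n {S w} → M , S , w ⊨ mark n → Marked n w
  mark⇒Marked n ((t , r , p) , q , (u , r′ , q′)) =
    (t , r , low⇒Low (suc n) p) ,
    (λ (v , r″ , p″) → q (v , r″ , Low⇒low n p″)) ,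
    (u , r′ , λ p′ → q′ (Low⇒low (suc n) p′))

  Marked⇒mark : ∀ n {S w} → Marked n w → M , S , w ⊨ mark n
  Marked⇒mark n ((t , r , p) , q , (u , r′ , q′)) =
    (t , r , Low⇒low (suc n) p) ,
    (λ (v , r″ , p″) → q (v , r″ , low⇒Low n p″)) ,
    (u , r′ , λ p′ → q′ (low⇒Low (suc n) p′))

  Low-mono : ∀ {m n} → m ≤ n → ∀ {w} → Low m w → Low n w
  Low-mono {n = zero}  z≤n     p = p
  Low-mono {n = suc n} z≤n     ()
  Low-mono (s≤s m≤n) p (t , r , ¬q) = p (t , r , λ q → ¬q (Low-mono m≤n q))

  -- The low successor required by the smaller mark is, by monotonicity, one that the larger mark
  -- forbids.
  Marked-< : ∀ {m n w} → m < n → Marked m w → ¬ Marked n w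
  Marked-< m<n ((t , r , p) , _) (_ , q , _) = q (t , r , Low-mono m<n p)

  Marked-unique : ∀ {m n w} → Marked m w → Marked n w → m ≡ n
  Marked-unique {m} {n} p q with <-cmp m n
  ... | tri< m<n _ _ = contradiction q (Marked-< m<n p)
  ... | tri≈ _ m≡n _ = m≡n
  ... | tri> _ _ m>n = contradiction p (Marked-< m>n q)

-- A guarded modal language over labelled structures.

record Structure (Λ : Set) : Set₁ where
  field
    W   : Set
    _⟶_ : W → W → Set
    lab : W → Λ → Set

memory : ∀ {W : Set} → List W → Pred W 0ℓ
memory []       = ∅
memory (w ∷ ws) = memory ws ∪ ｛ w ｝

module Guarded {Λ : Set} where

  data Guard : Set where
    any seen : Λ → Guard

  infixr 6 _&_

  data Guardedᶠ : Set where
    ⊤ᴳ ⊥ᴳ   : Guardedᶠ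
    at      : Λ → Guardedᶠ
    _&_     : Guardedᶠ → Guardedᶠ → Guardedᶠ
    box dia : Guard → Guardedᶠ → Guardedᶠ

  opaque
    -- Opaque, so that the conjunction over `elements` is used only through `every⁺` and `every⁻`.
    every : ∀ {A} → Finite A → (A → Guardedᶠ) → Guardedᶠ
    every fin f = foldr (λ x φ → f x & φ) ⊤ᴳ (elements fin)

  recall : Λ → Guardedᶠ
  recall ℓ = dia (seen ℓ) ⊤ᴳ

  module Semantics (𝔐 : Structure Λ) where
    open Structure 𝔐

    infix 4 _▸_⊩_

    ⟦_⟧ : Guard → List W → W → Set
    ⟦ any ℓ ⟧  ws t = lab t ℓ
    ⟦ seen ℓ ⟧ ws t = lab t ℓ × memory ws t

    -- The double negation in the box clause makes the translation below exact
    -- without classical reasoning.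
    _▸_⊩_ : List W → W → Guardedᶠ → Set
    ws ▸ w ⊩ ⊤ᴳ      = ⊤
    ws ▸ w ⊩ ⊥ᴳ      = ⊥
    ws ▸ w ⊩ at ℓ    = lab w ℓ
    ws ▸ w ⊩ φ & ψ   = (ws ▸ w ⊩ φ) × (ws ▸ w ⊩ ψ)
    ws ▸ w ⊩ box g φ = ∀ t → w ⟶ t → ⟦ g ⟧ (w ∷ ws) t → ¬ ¬ ((w ∷ ws) ▸ t ⊩ φ)
    ws ▸ w ⊩ dia g φ = ∃[ t ] (w ⟶ t × ⟦ g ⟧ (w ∷ ws) t × ((w ∷ ws) ▸ t ⊩ φ))

    opaque
      unfolding every

      every⁺ : ∀ {A ws w} (fin : Finite A) {f : A → Guardedᶠ} → (∀ x → ws ▸ w ⊩ f x) → ws ▸ w ⊩ every fin f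
      every⁺ {A} {ws} {w} fin {f} p = go (elements fin)
        where
        go : ∀ xs → ws ▸ w ⊩ foldr (λ x φ → f x & φ) ⊤ᴳ xs
        go []       = tt
        go (x ∷ xs) = p x , go xs

      every⁻ : ∀ {A ws w} (fin : Finite A) {f : A → Guardedᶠ} → ws ▸ w ⊩ every fin f → ∀ x → ws ▸ w ⊩ f x
      every⁻ {A} {ws} {w} fin {f} p x = go (complete fin x) p
        where
        go : ∀ {xs} → x ∈ xs → ws ▸ w ⊩ foldr (λ x φ → f x & φ) ⊤ᴳ xs → ws ▸ w ⊩ f x
        go (here refl) (p , _) = p
        go (there x∈)  (_ , p) = go x∈ p

    -- This is how a label names a remembered state: labels are unique, so if every visited state
    -- other than `u` has a label different from `ℓ`, only `u` is left.
    remembered : ∀ {t u ℓ ws} →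
                 (∀ {w ℓ ℓ′} → lab w ℓ → lab w ℓ′ → ℓ ≡ ℓ′) →
                 All (λ w → w ≡ u ⊎ (∃[ ℓ′ ] (lab w ℓ′ × ℓ′ ≢ ℓ))) ws →
                 lab t ℓ → memory ws t → u ≡ t
    remembered uniq (inj₁ refl ∷ _) l (inj₂ refl)            = refl
    remembered uniq (inj₂ (_ , l′ , ≢) ∷ _) l (inj₂ refl)    = contradiction (uniq l′ l) ≢
    remembered uniq (_ ∷ ps) l (inj₁ m)                      = remembered uniq ps l m

  -- Translation into formulas of the logic.

  module Translation (code : Λ → ℕ) where

    ⌈_⌉ᵍ : Guard → Formula
    ⌈ any ℓ ⌉ᵍ  = mark (code ℓ)
    ⌈ seen ℓ ⌉ᵍ = mark (code ℓ) ∧ 𝗄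

    ⌈_⌉ : Guardedᶠ → Formula
    ⌈ ⊤ᴳ ⌉      = verum
    ⌈ ⊥ᴳ ⌉      = falsum
    ⌈ at ℓ ⌉    = mark (code ℓ)
    ⌈ φ & ψ ⌉   = ⌈ φ ⌉ ∧ ⌈ ψ ⌉
    ⌈ box g φ ⌉ = ∼ ◇ (⌈ g ⌉ᵍ ∧ ∼ ⌈ φ ⌉)
    ⌈ dia g φ ⌉ = ◇ (⌈ g ⌉ᵍ ∧ ⌈ φ ⌉)

    module _ (M : Frame) where
      open Marks M

      marked : Structure Λ
      marked = record { W = Frame.W M ; _⟶_ = Frame.R M ; lab = λ w ℓ → Marked (code ℓ) w }

      open Semantics marked

      guard⁺ : ∀ g {ws t} → ⟦ g ⟧ ws t → M , memory ws , t ⊨ ⌈ g ⌉ᵍ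
      guard⁺ (any ℓ)  l       = Marked⇒mark (code ℓ) l
      guard⁺ (seen ℓ) (l , m) = Marked⇒mark (code ℓ) l , m

      guard⁻ : ∀ g {ws t} → M , memory ws , t ⊨ ⌈ g ⌉ᵍ → ⟦ g ⟧ ws t
      guard⁻ (any ℓ)  l       = mark⇒Marked (code ℓ) l
      guard⁻ (seen ℓ) (l , m) = mark⇒Marked (code ℓ) l , m

      ⌈⌉⁺ : ∀ φ {ws w} → ws ▸ w ⊩ φ → M , memory ws , w ⊨ ⌈ φ ⌉
      ⌈⌉⁻ : ∀ φ {ws w} → M , memory ws , w ⊨ ⌈ φ ⌉ → ws ▸ w ⊩ φ
      ⌈⌉⁺ ⊤ᴳ        _               = λ (k , ¬k) → ¬k k
      ⌈⌉⁺ (at ℓ)    l               = Marked⇒mark (code ℓ) l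
      ⌈⌉⁺ (φ & ψ)   (p , q)         = ⌈⌉⁺ φ p , ⌈⌉⁺ ψ q
      ⌈⌉⁺ (box g φ) p               = λ (t , r , l , ¬q) → p t r (guard⁻ g l) λ q → ¬q (⌈⌉⁺ φ q)
      ⌈⌉⁺ (dia g φ) (t , r , l , p) = t , r , guard⁺ g l , ⌈⌉⁺ φ p
      ⌈⌉⁻ ⊤ᴳ        _               = tt
      ⌈⌉⁻ ⊥ᴳ        (k , ¬k)        = ¬k k
      ⌈⌉⁻ (at ℓ)    l               = mark⇒Marked (code ℓ) l
      ⌈⌉⁻ (φ & ψ)   (p , q)         = ⌈⌉⁻ φ p , ⌈⌉⁻ ψ q
      ⌈⌉⁻ (box g φ) p t r l ¬q      = p (t , r , guard⁺ g l , λ q → ¬q (⌈⌉⁻ φ q))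
      ⌈⌉⁻ (dia g φ) (t , r , l , p) = t , r , guard⁻ g l , ⌈⌉⁻ φ p

    -- A structure with one label per state becomes a frame by adding a descending
    -- chain of states 0, 1, 2, … and an edge from each state to the code of its label.
    module Realisation
      (code-injective : ∀ {ℓ ℓ′} → code ℓ ≡ code ℓ′ → ℓ ≡ ℓ′)
      {W : Set} (_⟶_ : W → W → Set) (label : W → Λ)
      (serial : ∀ w → ∃[ t ] (w ⟶ t)) where

      labelled : Structure Λ
      labelled = record { W = W ; _⟶_ = _⟶_ ; lab = λ w ℓ → label w ≡ ℓ }

      R⁺ : W ⊎ ℕ → W ⊎ ℕ → Set
      R⁺ (inj₁ w) (inj₁ t) = w ⟶ t
      R⁺ (inj₁ w) (inj₂ n) = code (label w) ≡ n
      R⁺ (inj₂ m) (inj₁ t) = ⊥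
      R⁺ (inj₂ m) (inj₂ n) = m ≡ suc n

      frame : Frame
      frame = record { W = W ⊎ ℕ ; R = R⁺ }

      open Marks frame

      -- By seriality an original state always has an original successor, so no finite bound on its
      -- height can hold.
      ¬Low-state : ∀ n {w} → ¬ Low n (inj₁ w)
      ¬Low-state (suc n) {w} p = let (t , r) = serial w in p (inj₁ t , r , ¬Low-state n)

      Low-chain⁺ : ∀ {m n} → m < n → Low n (inj₂ m)
      Low-chain⁺ (s≤s m<n) (inj₂ _ , refl , ¬p) = ¬p (Low-chain⁺ m<n)

      Low-chain⁻ : ∀ {m n} → n ≤ m → ¬ Low n (inj₂ m)
      Low-chain⁻ z≤n       ()
      Low-chain⁻ (s≤s n≤m) p = p (inj₂ _ , refl , Low-chain⁻ n≤m)

      Marked-state : ∀ w → Marked (code (label w)) (inj₁ w)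
      Marked-state w = let (t , r) = serial w in
        (inj₂ _ , refl , Low-chain⁺ (n<1+n _)) ,
        (λ { (inj₁ _ , _ , p) → ¬Low-state _ p ; (inj₂ _ , refl , p) → Low-chain⁻ ≤-refl p }) ,
        (inj₁ t , r , ¬Low-state _)

      -- A mark needs a low and a high successor, but a chain state has at most one successor.
      ¬Marked-chain : ∀ {n m} → ¬ Marked n (inj₂ m)
      ¬Marked-chain ((inj₂ _ , refl , p) , _ , (inj₂ _ , refl , ¬p)) = ¬p p

      private
        module S = Semantics labelled
        module S⁺ = Semantics (marked frame)

      memory⁺ : ∀ (ws : List W) {t} → memory ws t → memory (map inj₁ ws) (inj₁ {B = ℕ} t)
      memory⁺ (w ∷ ws) (inj₁ m)    = inj₁ (memory⁺ ws m)
      memory⁺ (w ∷ ws) (inj₂ refl) = inj₂ refl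

      memory⁻ : ∀ (ws : List W) {t} → memory (map inj₁ ws) (inj₁ {B = ℕ} t) → memory ws t
      memory⁻ (w ∷ ws) (inj₁ m)  = inj₁ (memory⁻ ws m)
      memory⁻ (w ∷ ws) (inj₂ eq) = inj₂ (inj₁-injective eq)

      realise-guard⁺ : ∀ g ws {t} → S.⟦ g ⟧ ws t → S⁺.⟦ g ⟧ (map inj₁ ws) (inj₁ t)
      realise-guard⁺ (any ℓ)  ws refl       = Marked-state _
      realise-guard⁺ (seen ℓ) ws (refl , m) = Marked-state _ , memory⁺ ws m

      -- Chain states carry no mark, so guarded modalities never reach them and the added states
      -- stay invisible to the guarded language.
      realise-guard⁻ : ∀ g ws {t} → S⁺.⟦ g ⟧ (map inj₁ ws) t → ∃[ u ] (t ≡ inj₁ u × S.⟦ g ⟧ ws u)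
      realise-guard⁻ (any ℓ)  ws {inj₁ t} l       = t , refl , code-injective (Marked-unique {w = inj₁ t} (Marked-state t) l)
      realise-guard⁻ (any ℓ)  ws {inj₂ m} l       = contradiction l ¬Marked-chain
      realise-guard⁻ (seen ℓ) ws {inj₁ t} (l , m) = t , refl , code-injective (Marked-unique {w = inj₁ t} (Marked-state t) l) , memory⁻ ws m
      realise-guard⁻ (seen ℓ) ws {inj₂ m} (l , _) = contradiction l ¬Marked-chain

      realise : ∀ φ ws {w} → ws S.▸ w ⊩ φ → map inj₁ ws S⁺.▸ inj₁ w ⊩ φ
      realise ⊤ᴳ        ws p               = tt
      realise (at ℓ)    ws refl            = Marked-state _
      realise (φ & ψ)   ws (p , q)         = realise φ ws p , realise ψ ws q
      realise (dia g φ) ws (t , r , l , p) = inj₁ t , r , realise-guard⁺ g (_ ∷ ws) l , realise φ (_ ∷ ws) p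
      realise (box g φ) ws p _ r l with realise-guard⁻ g (_ ∷ ws) l
      ... | t , refl , l′ = p t r l′ >>= λ q → return (realise φ (_ ∷ ws) q)

      satisfiable : ∀ φ {w} → [] S.▸ w ⊩ φ → Satisfiable ⌈ φ ⌉
      satisfiable φ {w} p = frame , inj₁ w , ⌈⌉⁺ frame φ (realise φ [] p)

-- Machines with two stacks and the rules describing them.

opposite : Direction → Direction
opposite left  = right
opposite right = left

even : ∀ {A : Set} → List A → Bool
even []       = true
even (_ ∷ xs) = not (even xs)

Face : Set → Set
Face Γ = Maybe Γ × Bool

-- The parity tells a list node from its tail when both are remembered.
face : ∀ {Γ} → List Γ → Face Γ
face xs = head xs , even xs

data Mark (Γ : Set) : Set where
  ‵spy ‵origin : Mark Γ
  ‵cell        : Direction → Face Γ → Mark Γ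

-- `restore` reloads the right stack with the data list, so the data can be read more than once.
-- Both `halt` and `fail` stop the machine, but only `fail` is forbidden by the rules.
data Instruction (Γ K : Set) : Set where
  push    : Direction → Γ → K → Instruction Γ K
  pop     : Direction → (Maybe Γ → K) → Instruction Γ K
  restore : K → Instruction Γ K
  halt fail : Instruction Γ K

module StackMachine {Γ K : Set} (finΓ : Finite Γ) (finK : Finite K)
  (program : K → Instruction Γ K) (init : K) where

  Label : Set
  Label = Mark Γ ⊎ K

  pattern spy      = inj₁ ‵spy
  pattern origin   = inj₁ ‵origin
  pattern cell d x = inj₁ (‵cell d x)
  pattern ctl k    = inj₂ k

  open Guarded {Label}

  tops : Finite (Maybe Γ)
  tops = finite-Maybe finΓ

  faces : Finite (Face Γ)
  faces = finite-× tops finite-Bool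

  Stacks : Set
  Stacks = List Γ × List Γ

  get : Direction → Stacks → List Γ
  get left  (ls , rs) = ls
  get right (ls , rs) = rs

  set : Direction → List Γ → Stacks → Stacks
  set left  xs (ls , rs) = xs , rs
  set right xs (ls , rs) = ls , xs

  set-elim : ∀ d {xs st} (P : Direction → List Γ → Set) →
             P d xs → P (opposite d) (get (opposite d) st) → ∀ d′ → P d′ (get d′ (set d xs st))
  set-elim left  P p q left  = p
  set-elim left  P p q right = q
  set-elim right P p q left  = q
  set-elim right P p q right = p

  get-set : ∀ d {xs} st → get d (set d xs st) ≡ xs
  get-set left  st = refl
  get-set right st = refl

  get-set-opposite : ∀ d {xs} st → get (opposite d) (set d xs st) ≡ get (opposite d) st
  get-set-opposite left  st = refl
  get-set-opposite right st = refl

  Configuration : Set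
  Configuration = K × Stacks

  exec : List Γ → Instruction Γ K → Configuration → Configuration
  exec data′ (push d a k) (_ , st) = k , set d (a ∷ get d st) st
  exec data′ (pop d f)    (_ , st) = f (head (get d st)) , set d (drop 1 (get d st)) st
  exec data′ (restore k)  (_ , st) = k , set right data′ st
  exec data′ halt         c        = c
  exec data′ fail         c        = c

  move-on : List Γ → Configuration → Configuration
  move-on data′ c = exec data′ (program (proj₁ c)) c

  run : List Γ → ℕ → Configuration
  run data′ = fold (init , [] , data′) (move-on data′)

  -- Every rule is evaluated at the spy point. Its boxes remember a configuration
  -- node and the relevant list nodes; the diamond then finds the next one.
  popped : K → Direction → K → Face Γ → Face Γ → Guardedᶠ
  popped k d k′ x y =
    box (seen spy) $ box (seen (ctl k)) $ box (any (cell (opposite d) y)) $ box (seen spy) $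
    dia (any (ctl k′)) $ recall (cell d x) & recall (cell (opposite d) y)

  pushing : K → Direction → Γ → K → Face Γ → Face Γ → Guardedᶠ
  pushing k d a k′ x y =
    box (any (ctl k)) $ box (any (cell d x)) $
    -- List nodes see the spy point, which sees everything: the path returns through it to the
    -- remembered configuration, visits the other stack and ends at the spy point again.
    box (seen spy) $ box (seen (ctl k)) $ box (any (cell (opposite d) y)) $ box (seen spy) $
    dia (any (ctl k′)) $
      dia (any (cell d (just a , not (proj₂ x)))) (recall spy & recall (cell d x)) & recall (cell (opposite d) y)

  popping : K → Direction → (Maybe Γ → K) → Face Γ → Face Γ → Guardedᶠ
  -- An empty stack stays empty when popped, so its own node is passed on.
  popping k d f (nothing , b) y =
    box (any (ctl k)) $ box (any (cell d (nothing , b))) $ popped k d (f nothing) (nothing , b) y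
  -- The tail has the opposite parity, but its top symbol is unknown; hence the conjunction over
  -- `z`.
  popping k d f (just a , b) y = every tops λ z →
    box (any (ctl k)) $ box (any (cell d (just a , b))) $ box (any (cell d (z , not b))) $
    popped k d (f (just a)) (z , not b) y

  restoring : K → K → Face Γ → Face Γ → Guardedᶠ
  restoring k k′ x y =
    box (any (ctl k)) $ box (any (cell left x)) $ box (seen spy) $
    box (any origin) $ box (any (cell right y)) $ box (seen spy) $
    dia (any (ctl k′)) $ recall (cell left x) & recall (cell right y)

  obeys : K → Instruction Γ K → Guardedᶠ
  obeys k (push d a k′) = every faces λ x → every faces λ y → pushing k d a k′ x y
  obeys k (pop d f)     = every faces λ x → every faces λ y → popping k d f x y
  obeys k (restore k′)  = every faces λ x → every faces λ y → restoring k k′ x y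
  obeys k halt          = ⊤ᴳ
  obeys k fail          = box (any (ctl k)) ⊥ᴳ

  starting : Face Γ → Guardedᶠ
  starting y =
    box (any origin) $ box (any (cell right y)) $ box (seen spy) $
    dia (any (ctl init)) $ dia (any (cell left (nothing , true))) (recall spy) & recall (cell right y)

  rules : Guardedᶠ
  rules = at spy & every faces starting & every finK λ k → obeys k (program k)

  -- Spells out the data list from the origin on. Each node contributes a piece of formula that
  -- depends only on its symbol and parity, which is what makes the description easy to write down.
  chain : List Γ → Guardedᶠ
  chain []       = dia (any (cell right (nothing , true))) (recall spy)
  chain (a ∷ xs) = dia (any (cell right (just a , not (even xs)))) (recall spy & chain xs)

  theory : List Γ → Guardedᶠ
  theory data′ = rules & dia (any origin) (chain data′)

  -- Every model of the theory contains the whole run.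

  module Soundness (𝔐 : Structure Label) (data′ : List Γ)
    (functional : ∀ {w ℓ ℓ′} → Structure.lab 𝔐 w ℓ → Structure.lab 𝔐 w ℓ′ → ℓ ≡ ℓ′)
    {s : Structure.W 𝔐} (sat : Semantics._▸_⊩_ 𝔐 [] s (theory data′)) where

    open Structure 𝔐
    open Semantics 𝔐

    data Represents (d : Direction) : W → List Γ → Set where
      nil  : ∀ {n} → lab n (cell d (nothing , true)) → n ⟶ s → Represents d n []
      cons : ∀ {n n′ a xs} → lab n (cell d (face (a ∷ xs))) → n ⟶ s → n ⟶ n′ →
             Represents d n′ xs → Represents d n (a ∷ xs)

    Represents-label : ∀ {d n xs} → Represents d n xs → lab n (cell d (face xs))
    Represents-label (nil l _)      = l
    Represents-label (cons l _ _ _) = l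

    Represents-back : ∀ {d n xs} → Represents d n xs → n ⟶ s
    Represents-back (nil _ r)      = r
    Represents-back (cons _ r _ _) = r

    Points : W → Direction → List Γ → Set
    Points c d xs = ∃[ n ] (c ⟶ n × Represents d n xs)

    -- Only existence is claimed. Surplus nodes with the same labels do no harm, since the rules
    -- apply to all of them.
    Present : Configuration → Set
    Present (k , st) = ∃[ c ] (s ⟶ c × lab c (ctl k) × (∀ d → Points c d (get d st)))

    s-spy : lab s spy
    s-spy = proj₁ (proj₁ sat)

    -- `other` and `same` justify, for each state on the path from the latest back to the first,
    -- that it does not compete with the state to be recalled.
    other : ∀ {u w ℓ ℓ′} → lab w ℓ′ → ℓ′ ≢ ℓ → w ≡ u ⊎ (∃[ ℓ′ ] (lab w ℓ′ × ℓ′ ≢ ℓ))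
    other l ≢ = inj₂ (_ , l , ≢)

    same : ∀ {u ℓ} → u ≡ u ⊎ (∃[ ℓ′ ] (lab u ℓ′ × ℓ′ ≢ ℓ))
    same = inj₁ refl

    recalled : ∀ {u ℓ ws w} → All (λ v → v ≡ u ⊎ (∃[ ℓ′ ] (lab v ℓ′ × ℓ′ ≢ ℓ))) (w ∷ ws) →
               ws ▸ w ⊩ recall ℓ → w ⟶ u
    recalled ps (t , r , (l , m) , _) = subst (_ ⟶_) (sym (remembered functional ps l m)) r

    chain-represents : ∀ xs {ws w} → All (λ v → v ≡ s ⊎ (∃[ ℓ′ ] (lab v ℓ′ × ℓ′ ≢ spy))) (w ∷ ws) →
                       ws ▸ w ⊩ chain xs → Points w right xs
    chain-represents []       ps (n , r , l , back) = n , r , nil l (recalled (other l (λ ()) ∷ ps) back)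
    chain-represents (a ∷ xs) ps (n , r , l , back , rest) =
      let n≢spy = other l (λ ())
          (_ , r′ , rep) = chain-represents xs (n≢spy ∷ ps) rest
      in n , r , cons l (recalled (n≢spy ∷ ps) back) r′ rep

    data-node : ∃[ o ] (s ⟶ o × lab o origin × Points o right data′)
    data-node = let (o , r , l , p) = proj₂ sat in
      o , r , l , chain-represents data′ (other l (λ ()) ∷ same ∷ []) p

    cell-side : ∀ {d x y} → _≢_ {A = Label} (cell (opposite d) x) (cell d y)
    cell-side {left}  ()
    cell-side {right} ()

    cell-side-opposite : ∀ {d x y} → _≢_ {A = Label} (cell d x) (cell (opposite d) y)
    cell-side-opposite {left}  ()
    cell-side-opposite {right} ()

    cell-parity : ∀ {d x y b} → _≢_ {A = Label} (cell d (x , b)) (cell d (y , not b))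
    cell-parity {b = true}  ()
    cell-parity {b = false} ()

    present-init : ¬ ¬ Present (init , [] , data′)
    present-init =
      let (o , s→o , lo , r , o→r , Rr) = data-node
          rule = every⁻ faces (proj₁ (proj₂ (proj₁ sat))) (face data′)
          lr = Represents-label Rr
      in do
        p₁ ← rule _ s→o lo
        p₂ ← p₁ _ o→r lr
        -- The nested injections are positions in the memory, counted back from the latest state.
        c , s→c , lc , (l , c→l , ll , back) , to-r ← p₂ _ (Represents-back Rr) (s-spy , inj₁ (inj₁ (inj₂ refl)))
        let visited = other lc (λ ()) ∷ same ∷ other lr (λ ()) ∷ other lo (λ ()) ∷ same ∷ []
            c→r = recalled (other lc (λ ()) ∷ other s-spy (λ ()) ∷ same ∷ other lo (λ ()) ∷ other s-spy (λ ()) ∷ []) to-r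
        return (c , s→c , lc , λ where
          left  → l , c→l , nil ll (recalled (other ll (λ ()) ∷ visited) back)
          right → r , c→r , Rr)

    present-push : ∀ {k st} d {a k′} → [] ▸ s ⊩ obeys k (push d a k′) →
                   Present (k , st) → ¬ ¬ Present (k′ , set d (a ∷ get d st) st)
    present-push d rule (c , s→c , lc , points) =
      let (l , c→l , Rl) = points d
          (r , c→r , Rr) = points (opposite d)
          ll = Represents-label Rl
          lr = Represents-label Rr
      in do
        p₁ ← every⁻ faces (every⁻ faces rule _) _ _ s→c lc
        p₂ ← p₁ _ c→l ll
        p₃ ← p₂ _ (Represents-back Rl) (s-spy , inj₁ (inj₁ (inj₂ refl)))
        p₄ ← p₃ _ s→c (lc , inj₁ (inj₁ (inj₂ refl)))
        p₅ ← p₄ _ c→r lr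
        c⁺ , s→c⁺ , lc⁺ , (u , c⁺→u , lu , back , to-l) , to-r ← p₅ _ (Represents-back Rr) (s-spy , inj₁ (inj₁ (inj₂ refl)))
        let c⁺→r = recalled (other lc⁺ (λ ()) ∷ other s-spy (λ ()) ∷ same ∷ other lc (λ ()) ∷ other s-spy (λ ()) ∷
                             other ll cell-side-opposite ∷ other lc (λ ()) ∷ other s-spy (λ ()) ∷ []) to-r
            -- The new node `u` is itself in the memory. Its flipped parity excludes it even if its
            -- top symbol is also that of `l`.
            u→l  = recalled (other lu (λ eq → cell-parity (sym eq)) ∷ other lc⁺ (λ ()) ∷ other s-spy (λ ()) ∷ other lr cell-side ∷
                             other lc (λ ()) ∷ other s-spy (λ ()) ∷ same ∷ other lc (λ ()) ∷ other s-spy (λ ()) ∷ []) to-l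
            u→s  = recalled (other lu (λ ()) ∷ other lc⁺ (λ ()) ∷ same ∷ other lr (λ ()) ∷ other lc (λ ()) ∷ same ∷
                             other ll (λ ()) ∷ other lc (λ ()) ∷ same ∷ []) back
        return (c⁺ , s→c⁺ , lc⁺ , set-elim d (Points c⁺) (u , c⁺→u , cons lu u→s u→l Rl) (r , c⁺→r , Rr))

    present-pop : ∀ {k st} d {f} → [] ▸ s ⊩ obeys k (pop d f) →
                  Present (k , st) → ¬ ¬ Present (f (head (get d st)) , set d (drop 1 (get d st)) st)
    present-pop {st = st} d rule (c , s→c , lc , points)
      with get d st | points d | every⁻ faces rule (face (get d st))
    ... | [] | l , c→l , Rl | ruleₓ =
      let (r , c→r , Rr) = points (opposite d)
          ll = Represents-label Rl
          lr = Represents-label Rr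
      in do
        p₁ ← every⁻ faces ruleₓ _ _ s→c lc
        p₂ ← p₁ _ c→l ll
        p₃ ← p₂ _ (Represents-back Rl) (s-spy , inj₁ (inj₁ (inj₂ refl)))
        p₄ ← p₃ _ s→c (lc , inj₁ (inj₁ (inj₂ refl)))
        p₅ ← p₄ _ c→r lr
        c⁺ , s→c⁺ , lc⁺ , to-l , to-r ← p₅ _ (Represents-back Rr) (s-spy , inj₁ (inj₁ (inj₂ refl)))
        let c⁺→r = recalled (other lc⁺ (λ ()) ∷ other s-spy (λ ()) ∷ same ∷ other lc (λ ()) ∷ other s-spy (λ ()) ∷
                             other ll cell-side-opposite ∷ other lc (λ ()) ∷ other s-spy (λ ()) ∷ []) to-r
            c⁺→l = recalled (other lc⁺ (λ ()) ∷ other s-spy (λ ()) ∷ other lr cell-side ∷ other lc (λ ()) ∷ other s-spy (λ ()) ∷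
                             same ∷ other lc (λ ()) ∷ other s-spy (λ ()) ∷ []) to-l
        return (c⁺ , s→c⁺ , lc⁺ , set-elim d (Points c⁺) (l , c⁺→l , Rl) (r , c⁺→r , Rr))
    ... | a ∷ xs | l , c→l , cons {n′ = t} ll _ l→t Rt | ruleₓ =
      let (r , c→r , Rr) = points (opposite d)
          lr = Represents-label Rr
          -- The rule computes the parity of the tail as the negation of that of `a ∷ xs`, hence the
          -- double negation of `even xs`.
          lt = subst (λ b → lab t (cell d (head xs , b))) (sym (not-involutive (even xs))) (Represents-label Rt)
      in do
        p₁ ← every⁻ tops (every⁻ faces ruleₓ _) (head xs) _ s→c lc
        p₂ ← p₁ _ c→l ll
        p₃ ← p₂ _ l→t lt
        p₄ ← p₃ _ (Represents-back Rt) (s-spy , inj₁ (inj₁ (inj₁ (inj₂ refl))))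
        p₅ ← p₄ _ s→c (lc , inj₁ (inj₁ (inj₁ (inj₂ refl))))
        p₆ ← p₅ _ c→r lr
        c⁺ , s→c⁺ , lc⁺ , to-t , to-r ← p₆ _ (Represents-back Rr) (s-spy , inj₁ (inj₁ (inj₂ refl)))
        let c⁺→r = recalled (other lc⁺ (λ ()) ∷ other s-spy (λ ()) ∷ same ∷ other lc (λ ()) ∷ other s-spy (λ ()) ∷
                             other lt cell-side-opposite ∷ other ll cell-side-opposite ∷ other lc (λ ()) ∷ other s-spy (λ ()) ∷ []) to-r
            c⁺→t = recalled (other lc⁺ (λ ()) ∷ other s-spy (λ ()) ∷ other lr cell-side ∷ other lc (λ ()) ∷ other s-spy (λ ()) ∷
                             same ∷ other ll cell-parity ∷ other lc (λ ()) ∷ other s-spy (λ ()) ∷ []) to-t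
        return (c⁺ , s→c⁺ , lc⁺ , set-elim d (Points c⁺) (t , c⁺→t , Rt) (r , c⁺→r , Rr))

    present-restore : ∀ {k st k′} → [] ▸ s ⊩ obeys k (restore k′) →
                      Present (k , st) → ¬ ¬ Present (k′ , set right data′ st)
    present-restore {st = st} rule (c , s→c , lc , points) =
      let (l , c→l , Rl) = points left
          (o , s→o , lo , r , o→r , Rr) = data-node
          ll = Represents-label Rl
          lr = Represents-label Rr
      in do
        p₁ ← every⁻ faces (every⁻ faces rule _) _ _ s→c lc
        p₂ ← p₁ _ c→l ll
        p₃ ← p₂ _ (Represents-back Rl) (s-spy , inj₁ (inj₁ (inj₂ refl)))
        p₄ ← p₃ _ s→o lo
        p₅ ← p₄ _ o→r lr
        c⁺ , s→c⁺ , lc⁺ , to-l , to-r ← p₅ _ (Represents-back Rr) (s-spy , inj₁ (inj₁ (inj₂ refl)))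
        let c⁺→r = recalled (other lc⁺ (λ ()) ∷ other s-spy (λ ()) ∷ same ∷ other lo (λ ()) ∷ other s-spy (λ ()) ∷
                             other ll (λ ()) ∷ other lc (λ ()) ∷ other s-spy (λ ()) ∷ []) to-r
            c⁺→l = recalled (other lc⁺ (λ ()) ∷ other s-spy (λ ()) ∷ other lr (λ ()) ∷ other lo (λ ()) ∷ other s-spy (λ ()) ∷
                             same ∷ other lc (λ ()) ∷ other s-spy (λ ()) ∷ []) to-l
        return (c⁺ , s→c⁺ , lc⁺ , set-elim right {st = st} (Points c⁺) (r , c⁺→r , Rr) (l , c⁺→l , Rl))

    present-exec : ∀ {k st} i → [] ▸ s ⊩ obeys k i → Present (k , st) → ¬ ¬ Present (exec data′ i (k , st))
    present-exec {st = st} (push d a k′) rule p = present-push {st = st} d rule p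
    present-exec {st = st} (pop d f)     rule p = present-pop {st = st} d rule p
    present-exec {st = st} (restore k′)  rule p = present-restore {st = st} rule p
    present-exec           halt          rule p = return p
    present-exec           fail          rule p = return p

    rule-for : ∀ k → [] ▸ s ⊩ obeys k (program k)
    rule-for = every⁻ finK (proj₂ (proj₂ (proj₁ sat)))

    present : ∀ n → ¬ ¬ Present (run data′ n)
    present zero    = present-init
    present (suc n) = present n >>= present-exec {st = proj₂ (run data′ n)} (program k) (rule-for k)
      where k = proj₁ (run data′ n)

    never-fails : ∀ n → program (proj₁ (run data′ n)) ≢ fail
    never-fails n eq = present n λ (c , s→c , lc , _) →
      subst (λ i → [] ▸ s ⊩ obeys (proj₁ (run data′ n)) i) eq (rule-for _) c s→c lc id

  -- The canonical model of a run that never fails.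

  module Completeness (data′ : List Γ) (never-fails : ∀ n → program (proj₁ (run data′ n)) ≢ fail) where

    -- One configuration node for each moment of the run and one list node for each side and list,
    -- so that stacks share their tails.
    data Node : Set where
      spyⁿ originⁿ : Node
      confⁿ        : ℕ → Node
      cellⁿ        : Direction → List Γ → Node

    label : Node → Label
    label spyⁿ         = spy
    label originⁿ      = origin
    label (confⁿ n)    = ctl (proj₁ (run data′ n))
    label (cellⁿ d xs) = cell d (face xs)

    data _⟶_ : Node → Node → Set where
      from-spy : ∀ {w} → spyⁿ ⟶ w
      to-spy   : ∀ {w} → w ⟶ spyⁿ
      to-data  : originⁿ ⟶ cellⁿ right data′
      to-stack : ∀ {n} d {xs} → get d (proj₂ (run data′ n)) ≡ xs → confⁿ n ⟶ cellⁿ d xs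
      to-tail  : ∀ {d a xs} → cellⁿ d (a ∷ xs) ⟶ cellⁿ d xs

    canonical : Structure Label
    canonical = record { W = Node ; _⟶_ = _⟶_ ; lab = λ w ℓ → label w ≡ ℓ }

    open Semantics canonical

    -- The `box-` lemmas determine which targets a guard leaves in the canonical model, so that each
    -- rule is checked along a single path.
    box-conf : ∀ {k} {P : Node → Set} → (∀ n → proj₁ (run data′ n) ≡ k → P (confⁿ n)) →
               ∀ t → spyⁿ ⟶ t → label t ≡ ctl k → ¬ ¬ P t
    box-conf p (confⁿ n) _ refl = return (p n refl)

    box-origin : ∀ {P : Node → Set} → P originⁿ → ∀ t → spyⁿ ⟶ t → label t ≡ origin → ¬ ¬ P t
    box-origin p originⁿ _ _ = return p

    box-spy : ∀ {w} {P Q : Node → Set} → P spyⁿ → ∀ t → w ⟶ t → label t ≡ spy × Q t → ¬ ¬ P t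
    box-spy p spyⁿ _ _ = return p

    box-data : ∀ {x} {P : Node → Set} → (label (cellⁿ right data′) ≡ cell right x → P (cellⁿ right data′)) →
               ∀ t → originⁿ ⟶ t → label t ≡ cell right x → ¬ ¬ P t
    box-data p _ to-data l = return (p l)

    stack : Direction → ℕ → List Γ
    stack d n = get d (proj₂ (run data′ n))

    box-stack : ∀ {d x n} {P : Node → Set} → (label (cellⁿ d (stack d n)) ≡ cell d x → P (cellⁿ d (stack d n))) →
                ∀ t → confⁿ n ⟶ t → label t ≡ cell d x → ¬ ¬ P t
    box-stack p _ (to-stack d refl) refl = return (p refl)

    box-tail : ∀ {d x xs} {P : Node → Set} → (label (cellⁿ d (drop 1 xs)) ≡ cell d x → P (cellⁿ d (drop 1 xs))) →
               ∀ t → cellⁿ d xs ⟶ t → label t ≡ cell d x → ¬ ¬ P t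
    box-tail p _ to-tail l = return (p l)

    -- Many moments may share a control state. The guard `seen (ctl k)` still leads back to moment
    -- `n`, because `confⁿ n` is the only configuration on the path.
    Conf-unique : ℕ → List Node → Set
    Conf-unique n = All (λ w → w ≡ confⁿ n ⊎ (∃[ μ ] (label w ≡ inj₁ μ)))

    remembered-conf : ∀ {n ws t k} → Conf-unique n ws → label t ≡ ctl k → memory ws t → confⁿ n ≡ t
    remembered-conf (_ ∷ ps)            l (inj₁ m)    = remembered-conf ps l m
    remembered-conf (inj₁ refl ∷ _)     l (inj₂ refl) = refl
    remembered-conf (inj₂ (_ , l′) ∷ _) l (inj₂ refl) = contradiction (trans (sym l′) l) λ ()

    box-return : ∀ {n ws w k} {P : Node → Set} → Conf-unique n ws → P (confⁿ n) →
                 ∀ t → w ⟶ t → label t ≡ ctl k × memory ws t → ¬ ¬ P t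
    box-return {P = P} unique p t _ (l , m) = return (subst P (remembered-conf unique l m) p)

    cell-face : ∀ {d x y} → _≡_ {A = Label} (cell d x) (cell d y) → x ≡ y
    cell-face refl = refl

    drop-head : ∀ (xs : List Γ) → head xs ≡ nothing → drop 1 xs ≡ xs
    drop-head [] refl = refl

    conf-unique₁ : ∀ {n d xs} → Conf-unique n (spyⁿ ∷ cellⁿ d xs ∷ confⁿ n ∷ spyⁿ ∷ [])
    conf-unique₁ = inj₂ (_ , refl) ∷ inj₂ (_ , refl) ∷ inj₁ refl ∷ inj₂ (_ , refl) ∷ []

    conf-unique₂ : ∀ {n d e xs ys} → Conf-unique n (spyⁿ ∷ cellⁿ d xs ∷ cellⁿ e ys ∷ confⁿ n ∷ spyⁿ ∷ [])
    conf-unique₂ = inj₂ (_ , refl) ∷ inj₂ (_ , refl) ∷ inj₂ (_ , refl) ∷ inj₁ refl ∷ inj₂ (_ , refl) ∷ []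

    -- Stated for an instruction `i` instead of `program k`, so that the proof can match on it; the
    -- hypotheses retain the link to the run. The witness for each diamond at the spy point is the
    -- next moment.
    obeys⁺ : ∀ k i → (∀ n → proj₁ (run data′ n) ≡ k → run data′ (suc n) ≡ exec data′ i (run data′ n)) →
             (i ≡ fail → ∀ n → proj₁ (run data′ n) ≢ k) → [] ▸ spyⁿ ⊩ obeys k i
    obeys⁺ k (push d a k′) next _ = every⁺ faces λ x → every⁺ faces λ y →
      box-conf λ n k≡ → box-stack λ lx → box-spy $ box-return (conf-unique₁ {n}) $ box-stack λ ly → box-spy $
      let st = proj₂ (run data′ n) in
      confⁿ (suc n) , from-spy , cong (ctl ∘ proj₁) (next n k≡) ,
      (cellⁿ d (a ∷ stack d n) , to-stack d (trans (cong (get d ∘ proj₂) (next n k≡)) (get-set d st)) ,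
        cong (λ x → cell d (just a , not (proj₂ x))) (cell-face lx) ,
        (spyⁿ , to-spy , (refl , inj₁ (inj₁ (inj₂ refl))) , tt) ,
        (cellⁿ d (stack d n) , to-tail , (lx , inj₁ (inj₁ (inj₁ (inj₁ (inj₁ (inj₁ (inj₂ refl))))))) , tt)) ,
      (cellⁿ (opposite d) (stack (opposite d) n) ,
        to-stack (opposite d) (trans (cong (get (opposite d) ∘ proj₂) (next n k≡)) (get-set-opposite d st)) ,
        (ly , inj₁ (inj₁ (inj₂ refl))) , tt)
    obeys⁺ k (pop d f) next _ = every⁺ faces λ where
      (nothing , b) → every⁺ faces λ y →
        box-conf λ n k≡ → box-stack λ lx → box-spy $ box-return (conf-unique₁ {n}) $ box-stack λ ly → box-spy $
        let st = proj₂ (run data′ n)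
            head≡ = cong proj₁ (cell-face lx) in
        confⁿ (suc n) , from-spy , cong ctl (trans (cong proj₁ (next n k≡)) (cong f head≡)) ,
        (cellⁿ d (stack d n) ,
          to-stack d (trans (cong (get d ∘ proj₂) (next n k≡)) (trans (get-set d st) (drop-head (stack d n) head≡))) ,
          (lx , inj₁ (inj₁ (inj₁ (inj₁ (inj₁ (inj₂ refl)))))) , tt) ,
        (cellⁿ (opposite d) (stack (opposite d) n) ,
          to-stack (opposite d) (trans (cong (get (opposite d) ∘ proj₂) (next n k≡)) (get-set-opposite d st)) ,
          (ly , inj₁ (inj₁ (inj₂ refl))) , tt)
      (just a , b) → every⁺ faces λ y → every⁺ tops λ z →
        box-conf λ n k≡ → box-stack λ lx → box-tail λ lz → box-spy $ box-return (conf-unique₂ {n}) $ box-stack λ ly → box-spy $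
        let st = proj₂ (run data′ n)
            head≡ = cong proj₁ (cell-face lx) in
        confⁿ (suc n) , from-spy , cong ctl (trans (cong proj₁ (next n k≡)) (cong f head≡)) ,
        (cellⁿ d (drop 1 (stack d n)) ,
          to-stack d (trans (cong (get d ∘ proj₂) (next n k≡)) (get-set d st)) ,
          (lz , inj₁ (inj₁ (inj₁ (inj₁ (inj₁ (inj₂ refl)))))) , tt) ,
        (cellⁿ (opposite d) (stack (opposite d) n) ,
          to-stack (opposite d) (trans (cong (get (opposite d) ∘ proj₂) (next n k≡)) (get-set-opposite d st)) ,
          (ly , inj₁ (inj₁ (inj₂ refl))) , tt)
    obeys⁺ k (restore k′) next _ = every⁺ faces λ x → every⁺ faces λ y →
      box-conf λ n k≡ → box-stack λ lx → box-spy $ box-origin $ box-data λ ly → box-spy $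
      confⁿ (suc n) , from-spy , cong (ctl ∘ proj₁) (next n k≡) ,
      (cellⁿ left (stack left n) , to-stack left (cong (get left ∘ proj₂) (next n k≡)) ,
        (lx , inj₁ (inj₁ (inj₁ (inj₁ (inj₁ (inj₂ refl)))))) , tt) ,
      (cellⁿ right data′ , to-stack right (cong (get right ∘ proj₂) (next n k≡)) , (ly , inj₁ (inj₁ (inj₂ refl))) , tt)
    obeys⁺ k halt next _     = tt
    obeys⁺ k fail next never = box-conf λ n k≡ → never refl n k≡

    chain⁺ : ∀ xs {ws w} → memory (w ∷ ws) spyⁿ → w ⟶ cellⁿ right xs → ws ▸ w ⊩ chain xs
    chain⁺ []       m r = cellⁿ right [] , r , refl , (spyⁿ , to-spy , (refl , inj₁ m) , tt)
    chain⁺ (a ∷ xs) m r = cellⁿ right (a ∷ xs) , r , refl , (spyⁿ , to-spy , (refl , inj₁ m) , tt) , chain⁺ xs (inj₁ m) to-tail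

    holds : [] ▸ spyⁿ ⊩ theory data′
    holds =
      ( refl
      , every⁺ faces (λ y → box-origin $ box-data λ ly → box-spy $
          confⁿ 0 , from-spy , refl ,
          (cellⁿ left [] , to-stack left refl , refl , (spyⁿ , to-spy , (refl , inj₁ (inj₁ (inj₂ refl))) , tt)) ,
          (cellⁿ right data′ , to-stack right refl , (ly , inj₁ (inj₁ (inj₂ refl))) , tt))
      , every⁺ finK λ k → obeys⁺ k (program k) (λ { n refl → refl }) λ { eq n refl → never-fails n eq } )
      , originⁿ , from-spy , refl , chain⁺ data′ (inj₁ (inj₂ refl)) to-data

-- Finiteness of alphabets and control states; positions in words.

finite-Direction : Finite Direction
finite-Direction .elements = left ∷ right ∷ []
finite-Direction .complete left  = here refl
finite-Direction .complete right = there (here refl)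

finite-Letter : Finite Letter
finite-Letter .elements = ⟨∼⟩ ∷ ⟨∧⟩ ∷ ⟨◇⟩ ∷ ⟨𝗄⟩ ∷ []
finite-Letter .complete ⟨∼⟩ = here refl
finite-Letter .complete ⟨∧⟩ = there (here refl)
finite-Letter .complete ⟨◇⟩ = there (there (here refl))
finite-Letter .complete ⟨𝗄⟩ = there (there (there (here refl)))

finite-Symbol : ∀ {A m} → Finite A → Finite (Symbol A m)
finite-Symbol {m = m} fin .elements = blank ∷ map letter (elements fin) ++ map work (allFin m)
finite-Symbol fin .complete blank      = here refl
finite-Symbol fin .complete (letter c) = there (∈-++⁺ˡ (∈-map⁺ letter (complete fin c)))
finite-Symbol fin .complete (work i)   = there (∈-++⁺ʳ (map letter (elements fin)) (∈-map⁺ work (∈-allFin i)))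

finite-Control : ∀ n → Finite (Control n)
finite-Control n .elements = accept ∷ reject ∷ map state (allFin n)
finite-Control n .complete accept    = here refl
finite-Control n .complete reject    = there (here refl)
finite-Control n .complete (state q) = there (there (∈-map⁺ state (∈-allFin q)))

finite-Mark : ∀ {Γ} → Finite Γ → Finite (Mark Γ)
finite-Mark fin .elements = ‵spy ∷ ‵origin ∷ cartesianProductWith ‵cell (elements finite-Direction) (elements (finite-× (finite-Maybe fin) finite-Bool))
finite-Mark fin .complete ‵spy        = here refl
finite-Mark fin .complete ‵origin     = there (here refl)
finite-Mark fin .complete (‵cell d x) =
  there (there (∈-cartesianProductWith⁺ ‵cell (complete finite-Direction d) (complete (finite-× (finite-Maybe fin) finite-Bool) x)))

module _ {A : Set} where

  -- Positions serve as a cursor, with `nothing` for the end, so that finitely many control states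
  -- can emit a fixed word letter by letter.
  first : (xs : List A) → Maybe (Fin (length xs))
  first []       = nothing
  first (_ ∷ xs) = just zero

  next : (xs : List A) → Fin (length xs) → Maybe (Fin (length xs))
  next (_ ∷ xs) zero    = Maybe.map suc (first xs)
  next (_ ∷ xs) (suc i) = Maybe.map suc (next xs i)

  from : (xs : List A) → Maybe (Fin (length xs)) → List A
  from xs nothing  = []
  from xs (just i) = drop (toℕ i) xs

  from-first : ∀ xs → from xs (first xs) ≡ xs
  from-first []       = refl
  from-first (_ ∷ xs) = refl

  from-suc : ∀ x xs m → from (x ∷ xs) (Maybe.map suc m) ≡ from xs m
  from-suc x xs nothing  = refl
  from-suc x xs (just i) = refl

  from-next : ∀ xs i → from xs (just i) ≡ lookup xs i ∷ from xs (next xs i)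
  from-next (x ∷ xs) zero    = cong (x ∷_) (sym (trans (from-suc x xs (first xs)) (from-first xs)))
  from-next (x ∷ xs) (suc i) = trans (from-next xs i) (cong (lookup xs i ∷_) (sym (from-suc x xs (next xs i))))

-- A program that writes its own description and runs the Turing machine on it.

data Pass : Set where
  copying quoting : Pass

-- The occasions for emitting a fixed word. The data are read twice: `copying` is to reproduce the
-- encoded rules, `quoting` to describe the data list itself.
data Token : Set where
  opening middle closing : Token
  item             : Pass → Letter → Token

finite-Token : Finite Token
finite-Token .elements = opening ∷ middle ∷ closing ∷ cartesianProductWith item (copying ∷ quoting ∷ []) (elements finite-Letter)
finite-Token .complete opening            = here refl
finite-Token .complete middle           = there (here refl)
finite-Token .complete closing              = there (there (here refl))
finite-Token .complete (item copying c) = there (there (there (∈-cartesianProductWith⁺ item {xs = copying ∷ quoting ∷ []} (here refl) (complete finite-Letter c))))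
finite-Token .complete (item quoting c) = there (there (there (∈-cartesianProductWith⁺ item {xs = copying ∷ quoting ∷ []} (there (here refl)) (complete finite-Letter c))))

module Program (T : TM Letter) (word : Token → List Letter) where
  open TM T

  Γ : Set
  Γ = Symbol Letter #work

  finite-Γ : Finite Γ
  finite-Γ = finite-Symbol finite-Letter

  data K : Set where
    rewind transfer : K
    scan    : Pass → K
    emit    : (t : Token) → Fin (length (word t)) → K
    unload  : Γ → K
    execute : Control #states → Γ → K
    shift   : Direction → Control #states → K

  unloads executes shifts : List K
  unloads  = map unload (elements finite-Γ)
  executes = cartesianProductWith execute (elements (finite-Control #states)) (elements finite-Γ)
  shifts   = cartesianProductWith shift (elements finite-Direction) (elements (finite-Control #states))

  emits : Token → List K
  emits t = map (emit t) (allFin (length (word t)))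

  finite-K : Finite K
  finite-K .elements =
    rewind ∷ transfer ∷ scan copying ∷ scan quoting ∷ unloads ++ executes ++ shifts ++ concatMap emits (elements finite-Token)
  finite-K .complete rewind         = here refl
  finite-K .complete transfer       = there (here refl)
  finite-K .complete (scan copying) = there (there (here refl))
  finite-K .complete (scan quoting) = there (there (there (here refl)))
  finite-K .complete (unload a)     = there (there (there (there (∈-++⁺ˡ (∈-map⁺ unload (complete finite-Γ a))))))
  finite-K .complete (execute q a)  = there (there (there (there (∈-++⁺ʳ unloads (∈-++⁺ˡ
    (∈-cartesianProductWith⁺ execute (complete (finite-Control #states) q) (complete finite-Γ a)))))))
  finite-K .complete (shift d q)    = there (there (there (there (∈-++⁺ʳ unloads (∈-++⁺ʳ executes (∈-++⁺ˡ
    (∈-cartesianProductWith⁺ shift (complete finite-Direction d) (complete (finite-Control #states) q))))))))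
  finite-K .complete (emit t i)     = there (there (there (there (∈-++⁺ʳ unloads (∈-++⁺ʳ executes (∈-++⁺ʳ shifts
    (∈-concatMap⁺ emits (lose (complete finite-Token t) (∈-map⁺ (emit t) (∈-allFin i))))))))))

  continue : Token → K
  continue opening      = scan copying
  continue (item π _) = scan π
  continue middle     = scan quoting
  continue closing        = transfer

  resume : (t : Token) → Maybe (Fin (length (word t))) → K
  resume t nothing  = continue t
  resume t (just i) = emit t i

  enter : Token → K
  enter t = resume t (first (word t))

  ended : Pass → K
  ended copying = rewind
  ended quoting = enter closing

  scanned : Pass → Maybe Γ → K
  scanned π nothing           = ended π
  scanned π (just (letter c)) = enter (item π c)
  scanned π (just _)          = scan π

  -- The output is emitted reversed onto the left stack, transferred to the right one, and then `T`
  -- is simulated: the stacks are the two tape halves, the scanned symbol sits in the control state,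
  -- and acceptance becomes `fail`.
  program : K → Instruction Γ K
  program rewind                = restore (enter middle)
  program transfer              = pop left (maybe unload (shift right start))
  program (scan π)              = pop right (scanned π)
  program (emit t i)            = push left (letter (lookup (word t) i)) (resume t (next (word t) i))
  program (unload a)            = push right a transfer
  program (execute (state q) a) = let (q′ , b , d) = δ q a in push (opposite d) b (shift d q′)
  program (execute accept a)    = fail
  program (execute reject a)    = halt
  -- An empty stack stands for the blank cells beyond the listed tape.
  program (shift d q)           = pop d (execute q ∘ fromMaybe blank)

  open StackMachine finite-Γ finite-K program (enter opening) public

  -- The blanks keep the parity of each letter's position, hence its label, fixed.
  spaced : List Letter → List Γ
  spaced = concatMap λ c → letter c ∷ blank ∷ []

  output : List Letter → List Letter
  output p = word opening ++ concatMap (word ∘ item copying) p ++ word middle ++ concatMap (word ∘ item quoting) p ++ word closing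

  module Run (data′ : List Γ) where

    advance : Configuration → Configuration
    advance = move-on data′

    infix 4 _↝_

    _↝_ : Configuration → Configuration → Set
    c ↝ c′ = ∃[ n ] (fold c advance n ≡ c′)

    ↝-trans : ∀ {c c′ c″} → c ↝ c′ → c′ ↝ c″ → c ↝ c″
    ↝-trans (m , refl) (n , refl) = n + m , fold-+ _ advance n

    ↝-step : ∀ {c c′} → advance c ↝ c′ → c ↝ c′
    ↝-step = ↝-trans (1 , refl)

    written : List Letter → List Γ → List Γ
    written us ls = map letter us ʳ++ ls

    written-++ : ∀ us vs {ls} → written vs (written us ls) ≡ written (us ++ vs) ls
    written-++ us vs {ls} = sym (trans (cong (_ʳ++ ls) (map-++ letter us vs)) (++-ʳ++ (map letter us)))

    resume-run : ∀ t us m {ls rs} → from (word t) m ≡ us → (resume t m , ls , rs) ↝ (continue t , written us ls , rs)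
    resume-run t []       nothing  eq = 0 , refl
    resume-run t []       (just i) eq = contradiction (trans (sym (from-next (word t) i)) eq) λ ()
    resume-run t (u ∷ us) (just i) eq with trans (sym (from-next (word t) i)) eq
    ... | refl = ↝-step (resume-run t us (next (word t) i) refl)

    enter-run : ∀ t {ls rs} → (enter t , ls , rs) ↝ (continue t , written (word t) ls , rs)
    enter-run t = resume-run t (word t) (first (word t)) (from-first (word t))

    scan-run : ∀ π p {ls} → (scan π , ls , spaced p) ↝ (ended π , written (concatMap (word ∘ item π) p) ls , [])
    scan-run π []      = 1 , refl
    -- The first step reads `c`; the second, after its word is written, skips the blank behind it.
    scan-run π (c ∷ p) {ls} = ↝-step (↝-trans (enter-run (item π c)) (↝-step
      (subst (λ ls′ → (scan π , written (word (item π c)) ls , spaced p) ↝ (ended π , ls′ , []))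
        (written-++ (word (item π c)) _) (scan-run π p))))

    transfer-run : ∀ ls {rs} → (transfer , ls , rs) ↝ (shift right start , [] , ls ʳ++ rs)
    transfer-run []       = 1 , refl
    transfer-run (l ∷ ls) = ↝-step (↝-step (transfer-run ls))

    configuration : Config T → Configuration
    configuration (q , tape ls a rs) = execute q a , ls , rs

    shift-run : ∀ w → advance (shift right start , [] , map letter w) ≡ configuration (initial T w)
    shift-run []      = refl
    shift-run (_ ∷ _) = refl

    -- A step of `T` takes two moves: `execute` pushes the written symbol on the side that the head
    -- leaves, and `shift` pops the next scanned symbol.
    advance-twice : ∀ c → advance (advance (configuration c)) ≡ configuration (step T c)
    advance-twice (accept  , _) = refl
    advance-twice (reject  , _) = refl
    advance-twice (state q , tape ls a rs) with δ q a
    advance-twice (state q , tape []       a rs) | q′ , b , left  = refl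
    advance-twice (state q , tape (l ∷ ls) a rs) | q′ , b , left  = refl
    advance-twice (state q , tape ls a [])       | q′ , b , right = refl
    advance-twice (state q , tape ls a (r ∷ rs)) | q′ , b , right = refl

    simulates : ∀ n {c} → fold (configuration c) advance (n * 2) ≡ configuration (fold c (step T) n)
    simulates zero    = refl
    simulates (suc n) {c} = trans (cong (advance ∘ advance) (simulates n)) (advance-twice (fold c (step T) n))

    stuck : ∀ n {c} → program (proj₁ c) ≡ fail → fold c advance n ≡ c
    stuck zero    eq = refl
    stuck (suc n) {c} eq = trans (cong advance (stuck n eq)) (cong (λ i → exec data′ i c) eq)

  fail⇒accept : ∀ {q a} → program (execute q a) ≡ fail → q ≡ accept
  fail⇒accept {accept} eq = refl

  module _ (p : List Letter) where
    open Run (spaced p)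

    prepares : (enter opening , [] , spaced p) ↝ configuration (initial T (output p))
    prepares =
      -- The bare `↝-step` is the `restore` between the passes; the last move pops the first tape
      -- symbol.
      ↝-trans (enter-run opening) $ ↝-trans (scan-run copying p) $ ↝-step $ ↝-trans (enter-run middle) $
      ↝-trans (scan-run quoting p) $ ↝-trans (enter-run closing) $ ↝-trans (transfer-run _) $ 1 , eq
      where
      u₁ = word opening
      u₂ = concatMap (word ∘ item copying) p
      u₃ = word middle
      u₄ = concatMap (word ∘ item quoting) p
      u₅ = word closing
      tape≡ : written u₅ (written u₄ (written u₃ (written u₂ (written u₁ [])))) ≡ written (output p) []
      tape≡ rewrite written-++ u₄ u₅ {written u₃ (written u₂ (written u₁ []))}
                  | written-++ u₃ (u₄ ++ u₅) {written u₂ (written u₁ [])}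
                  | written-++ u₂ (u₃ ++ u₄ ++ u₅) {written u₁ []}
                  | written-++ u₁ (u₂ ++ u₃ ++ u₄ ++ u₅) {[]} = refl
      eq : advance (shift right start , [] , written u₅ (written u₄ (written u₃ (written u₂ (written u₁ [])))) ʳ++ []) ≡ configuration (initial T (output p))
      -- The transfer reverses the output a second time and so restores its order.
      eq = trans
        (cong (λ rs → advance (shift right start , [] , rs))
          (trans (cong (_ʳ++ []) tape≡) (trans (ʳ++-ʳ++ (map letter (output p))) (++-identityʳ _))))
        (shift-run (output p))

    run-configuration : ∃[ N ] (∀ n → run (spaced p) (n * 2 + N) ≡ configuration (iterate (step T) (initial T (output p)) n))
    run-configuration = let (N , eq) = prepares in
      N , λ n → trans (fold-+ _ advance (n * 2)) (trans (cong (λ c → fold c advance (n * 2)) eq)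
        (trans (simulates n) (cong configuration (iterate-is-fold _ (step T) n))))

    accepts⇒fails : Accepts T (output p) → ∃[ n ] (program (proj₁ (run (spaced p) n)) ≡ fail)
    accepts⇒fails (n , acc) = let (N , eq) = run-configuration in
      n * 2 + N , trans (cong (program ∘ proj₁) (eq n)) (cong (λ q → program (execute q (Tape.scan (proj₂ (iterate (step T) (initial T (output p)) n))))) acc)

    -- A failing configuration is fixed, so it is still there at the later moment `n * 2 + N`, which
    -- shows the configuration of `T` after `n` steps.
    fails⇒accepts : ∀ n → program (proj₁ (run (spaced p) n)) ≡ fail → Accepts T (output p)
    fails⇒accepts n failed = n , fail⇒accept (trans (cong (program ∘ proj₁) (sym same-configuration)) failed)
      where
      open ≡-Reasoning
      N = proj₁ run-configuration
      m = n * 2 + N ∸ n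
      same-configuration : run (spaced p) n ≡ configuration (iterate (step T) (initial T (output p)) n)
      same-configuration = begin
        run (spaced p) n                  ≡⟨ stuck m failed ⟨
        fold (run (spaced p) n) advance m ≡⟨ fold-+ _ advance m ⟨
        run (spaced p) (m + n)            ≡⟨ cong (run (spaced p)) (m∸n+n≡m (≤-trans (m≤m*n n 2) (m≤m+n (n * 2) N))) ⟩
        run (spaced p) (n * 2 + N)        ≡⟨ proj₂ run-configuration n ⟩
        configuration (iterate (step T) (initial T (output p)) n) ∎

-- The self-referential formula.

module Diagonal (T : TM Letter) where

  marks : Finite (Mark (Symbol Letter (TM.#work T)))
  marks = finite-Mark (finite-Symbol finite-Letter)

  -- The translation of `recall spy`, written out because `code` is defined only after the program.
  back : Formula
  back = ◇ ((mark (Finite.rank marks ‵spy) ∧ 𝗄) ∧ verum)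

  -- In Polish notation the encoding of a nested `chain` is a concatenation; this is the share of
  -- one node.
  cell-word : Symbol Letter (TM.#work T) → Bool → List Letter
  cell-word a b = ⟨◇⟩ ∷ ⟨∧⟩ ∷ encode (mark (Finite.rank marks (‵cell right (just a , b)))) ++ ⟨∧⟩ ∷ encode back

  word : Token → List Letter
  word opening          = [ ⟨∧⟩ ]
  word (item copying c) = [ c ]
  -- In a spaced list, suffixes starting with a letter have even length and those starting with a
  -- blank odd length.
  word (item quoting c) = cell-word (letter c) true ++ cell-word blank false
  word middle           = ⟨◇⟩ ∷ ⟨∧⟩ ∷ encode (mark (Finite.rank marks ‵origin))
  word closing          = encode (◇ (mark (Finite.rank marks (‵cell right (nothing , true))) ∧ back))

  open Program T word

  -- Control labels are numbered after the marks, so that `word`, on which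
  -- the control states depend, does not depend on them in turn.
  code : Label → ℕ
  code (inj₁ μ) = Finite.rank marks μ
  code (inj₂ k) = length (elements marks) + Finite.rank finite-K k

  mark≢control : ∀ μ k → code (inj₁ μ) ≢ code (inj₂ k)
  mark≢control μ k eq = <-irrefl eq (≤-trans (Finite.rank< marks μ) (m≤m+n _ _))

  code-injective : ∀ {ℓ ℓ′} → code ℓ ≡ code ℓ′ → ℓ ≡ ℓ′
  code-injective {inj₁ μ} {inj₁ ν} eq = cong inj₁ (Finite.rank-injective marks eq)
  code-injective {inj₁ μ} {inj₂ k} eq = contradiction eq (mark≢control μ k)
  code-injective {inj₂ k} {inj₁ μ} eq = contradiction (sym eq) (mark≢control μ k)
  code-injective {inj₂ k} {inj₂ l} eq = cong inj₂ (Finite.rank-injective finite-K (+-cancelˡ-≡ _ _ _ eq))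

  open Guarded {Label}
  open Translation code

  -- The rules mention the program but not its data, so their encoding may serve as that data
  -- without circularity.
  quoted-rules : List Letter
  quoted-rules = encode ⌈ rules ⌉

  diagonal : Formula
  diagonal = ⌈ theory (spaced quoted-rules) ⌉

  satisfiable⇒never-fails : ∀ data′ → Satisfiable ⌈ theory data′ ⌉ → ∀ n → program (proj₁ (run data′ n)) ≢ fail
  satisfiable⇒never-fails data′ (M , w , p) = Soundness.never-fails (marked M) data′
    (λ {w} l l′ → code-injective (Marks.Marked-unique M {w = w} l l′)) (⌈⌉⁻ M (theory data′) p)

  never-fails⇒satisfiable : ∀ data′ → (∀ n → program (proj₁ (run data′ n)) ≢ fail) → Satisfiable ⌈ theory data′ ⌉
  never-fails⇒satisfiable data′ never =
    Realisation.satisfiable code-injective C._⟶_ C.label (λ _ → C.spyⁿ , C.to-spy) (theory data′) C.holds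
    where module C = Completeness data′ never

  even-spaced : ∀ p → even (spaced p) ≡ true
  even-spaced []      = refl
  even-spaced (_ ∷ p) = trans (not-involutive _) (even-spaced p)

  encode-cell : ∀ a xs → encode ⌈ chain (a ∷ xs) ⌉ ≡ cell-word a (not (even xs)) ++ encode ⌈ chain xs ⌉
  encode-cell a xs = cong (λ v → ⟨◇⟩ ∷ ⟨∧⟩ ∷ v)
    (sym (++-assoc (encode (mark (Finite.rank marks (‵cell right (just a , not (even xs)))))) (⟨∧⟩ ∷ encode back) _))

  encode-chain : ∀ p → encode ⌈ chain (spaced p) ⌉ ≡ concatMap (word ∘ item quoting) p ++ word closing
  encode-chain []      = refl
  encode-chain (c ∷ p) = begin
    encode ⌈ chain (letter c ∷ blank ∷ spaced p) ⌉
      ≡⟨ encode-cell (letter c) (blank ∷ spaced p) ⟩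
    cell-word (letter c) (even (spaced (c ∷ p))) ++ encode ⌈ chain (blank ∷ spaced p) ⌉
      ≡⟨ cong₂ (λ b v → cell-word (letter c) b ++ v) (even-spaced (c ∷ p)) (encode-cell blank (spaced p)) ⟩
    cell-word (letter c) true ++ cell-word blank (not (even (spaced p))) ++ encode ⌈ chain (spaced p) ⌉
      ≡⟨ cong₂ (λ b v → cell-word (letter c) true ++ cell-word blank (not b) ++ v) (even-spaced p) (encode-chain p) ⟩
    cell-word (letter c) true ++ cell-word blank false ++ concatMap (word ∘ item quoting) p ++ word closing
      ≡⟨ ++-assoc (cell-word (letter c) true) (cell-word blank false) _ ⟨
    word (item quoting c) ++ concatMap (word ∘ item quoting) p ++ word closing
      ≡⟨ ++-assoc (word (item quoting c)) _ _ ⟨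
    concatMap (word ∘ item quoting) (c ∷ p) ++ word closing ∎
    where open ≡-Reasoning

  -- The fixed point: copying emits singletons and gives back the encoded rules, while quoting gives
  -- the encoded description of the data.
  output-diagonal : output quoted-rules ≡ encode diagonal
  output-diagonal = cong (⟨∧⟩ ∷_) (cong₂ _++_ (concatMap-pure quoted-rules)
    (cong (λ v → word middle ++ v) (sym (encode-chain quoted-rules))))

  satisfiable⇒¬accepts : Satisfiable diagonal → ¬ Accepts T (encode diagonal)
  satisfiable⇒¬accepts sat acc =
    let (n , failed) = accepts⇒fails quoted-rules (subst (Accepts T) (sym output-diagonal) acc)
    in satisfiable⇒never-fails _ sat n failed

  ¬accepts⇒satisfiable : ¬ Accepts T (encode diagonal) → Satisfiable diagonal
  ¬accepts⇒satisfiable ¬acc = never-fails⇒satisfiable _ λ n failed →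
    ¬acc (subst (Accepts T) output-diagonal (fails⇒accepts quoted-rules n failed))

-- Exclusiveness of the verdicts, and undecidability.

iterate-+ : ∀ {A : Set} (f : A → A) x m n → iterate f x (m + n) ≡ iterate f (iterate f x m) n
iterate-+ f x zero    n = refl
iterate-+ f x (suc m) n = iterate-+ f (f x) m n

module _ {A : Set} (T : TM A) where

  accept-fixed : ∀ n {c} → proj₁ c ≡ accept → proj₁ (iterate (step T) c n) ≡ accept
  accept-fixed zero    refl = refl
  accept-fixed (suc n) refl = accept-fixed n refl

  reject-fixed : ∀ n {c} → proj₁ c ≡ reject → proj₁ (iterate (step T) c n) ≡ reject
  reject-fixed zero    refl = refl
  reject-fixed (suc n) refl = reject-fixed n refl

  -- Halted configurations are fixed, so both verdicts would hold at time `n + m`.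
  rejects⇒¬accepts : ∀ w → Rejects T w → ¬ Accepts T w
  rejects⇒¬accepts w (m , rej) (n , acc) = contradiction (trans (sym accepted) rejected) λ ()
    where
    c = initial T w
    accepted : proj₁ (iterate (step T) c (n + m)) ≡ accept
    accepted = trans (cong proj₁ (iterate-+ (step T) c n m)) (accept-fixed m acc)
    rejected : proj₁ (iterate (step T) c (n + m)) ≡ reject
    rejected = trans (cong (proj₁ ∘ iterate (step T) c) (+-comm n m))
      (trans (cong proj₁ (iterate-+ (step T) c m n)) (reject-fixed n rej))

theorem2 : ¬ (∃[ T ] Decides T Satisfiable)
-- Satisfiability would force `T` to accept, which rules out satisfiability. So `T` rejects and
-- hence does not accept, which makes the formula satisfiable after all.
theorem2 (T , decides) = unsatisfiable (¬accepts⇒satisfiable (rejects⇒¬accepts T (encode diagonal) (proj₂ (decides diagonal) unsatisfiable)))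
  where
  open Diagonal T
  unsatisfiable : ¬ Satisfiable diagonal
  unsatisfiable sat = satisfiable⇒¬accepts sat (proj₁ (decides diagonal) sat)
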